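{- Let $G$ be a finite, simple, connected graph with $\dim_{wt}(G)=2$ and let $\{u,v\}$ be a weak total metric basis of $G$. Then $u$ and $v$ each have degree at most two.
   Context: $d(x,y)$ is the shortest-path distance. A set $W\subseteq V(G)$ is a resolving set if for every two distinct vertices $y,z$ there is $x\in W$ with $d(y,x)\ne d(z,x)$. A set $W$ is a weak total resolving set (WTR-set) if $W$ is resolving and, for every $w\in W$ and every $x\in V(G)\setminus W$, there is $w'\in W\setminus\{w\}$ with $d(x,w')\ne d(w,w')$. $\dim_{wt}(G)$ is the minimum cardinality of a WTR-set, and a weak total metric basis is a WTR-set of that cardinality. -}

module Defs where

open import Data.Fin.Base using (Fin)
open import Data.Fin.Properties using (any?; all?; _≟_)
open import Data.Fin.Subset using (Subset; _∈_; _∉_; _-_; ∣_∣; ⊤)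
open import Data.Fin.Subset.Properties using (_∈?_; ∈⊤; anySubset?)
open import Data.Nat.Base using (ℕ; zero; suc; _≤_; z≤n; s≤s)
import Data.Nat.Properties as ℕ
open import Data.Product.Base using (∃; _×_; _,_; proj₁; proj₂)
open import Data.Vec.Base using (tabulate)
open import Function.Base using (_∘_)
open import Level using (0ℓ)
open import Relation.Binary.Core using (Rel)
open import Relation.Binary.Definitions using (Decidable; Symmetric; Irreflexive)
open import Relation.Binary.PropositionalEquality
  using (_≡_; _≢_; refl; sym; trans; subst)
open import Relation.Nullary.Decidable
  using (Dec; yes; no; does; map′; ¬?; _×-dec_; _→-dec_)
open import Relation.Nullary.Negation using (contradiction)
open import Relation.Unary using (Pred) renaming (Decidable to Decidable₁)

IsMinimum : Pred ℕ 0ℓ → ℕ → Set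
IsMinimum P m = P m × (∀ {k} → P k → m ≤ k)

minimum : {P : Pred ℕ 0ℓ} → Decidable₁ P → ∀ k → P k → ∃ (IsMinimum P)
minimum P? zero p = zero , p , λ _ → z≤n
minimum {P} P? (suc k) p with P? zero
... | yes p₀ = zero , p₀ , λ _ → z≤n
... | no ¬p₀ with minimum {P ∘ suc} (P? ∘ suc) k p
...   | m , pm , least = suc m , pm , λ
  { {zero}  p₀ → contradiction p₀ ¬p₀
  ; {suc j} pj → s≤s (least pj)
  }

record Graph (n : ℕ) : Set₁ where
  infix 4 _~_ _~?_
  field
    _~_      : Rel (Fin n) 0ℓ
    _~?_     : Decidable _~_
    ~-sym    : Symmetric _~_
    ~-irrefl : Irreflexive _≡_ _~_

module _ {n : ℕ} (G : Graph n) where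
  open Graph G

  neighbours : Fin n → Subset n
  neighbours x = tabulate (λ y → does (x ~? y))

  degree : Fin n → ℕ
  degree x = ∣ neighbours x ∣

  -- Vertices may repeat along a walk.  A shortest walk is necessarily a path,
  -- so minimising the length over walks gives the shortest-path distance.
  data Walk : Fin n → Fin n → ℕ → Set where
    []  : ∀ {x} → Walk x x zero
    _∷_ : ∀ {x y z k} → x ~ y → Walk y z k → Walk x z (suc k)

  Connected : Set
  Connected = ∀ x y → ∃ (Walk x y)

  walk? : ∀ x y k → Dec (Walk x y k)
  walk? x y zero    = map′ (λ { refl → [] }) (λ { [] → refl }) (x ≟ y)
  walk? x z (suc k) = map′ (λ { (_ , e , w) → e ∷ w }) (λ { (e ∷ w) → _ , e , w })
                           (any? λ y → (x ~? y) ×-dec walk? y z k)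

  module _ (conn : Connected) where

    distance : ∀ x y → ∃ (IsMinimum (Walk x y))
    distance x y = let k , w = conn x y in minimum (walk? x y) k w

    d : Fin n → Fin n → ℕ
    d x y = proj₁ (distance x y)

    Resolving : Subset n → Set
    Resolving W = ∀ y z → y ≢ z → ∃ λ x → x ∈ W × d y x ≢ d z x

    WeakTotalResolving : Subset n → Set
    WeakTotalResolving W =
      Resolving W ×
      (∀ w → w ∈ W → ∀ x → x ∉ W → ∃ λ w′ → w′ ∈ W - w × d x w′ ≢ d w w′)

    weakTotalResolving? : Decidable₁ WeakTotalResolving
    weakTotalResolving? W =
      all? (λ y → all? λ z → ¬? (y ≟ z) →-dec
        any? λ x → (x ∈? W) ×-dec ¬? (d y x ℕ.≟ d z x))
      ×-dec
      all? (λ w → (w ∈? W) →-dec all? λ x → ¬? (x ∈? W) →-dec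
        any? λ w′ → (w′ ∈? (W - w)) ×-dec ¬? (d x w′ ℕ.≟ d w w′))

    d-refl : ∀ x → d x x ≡ 0
    d-refl x = ℕ.n≤0⇒n≡0 (proj₂ (proj₂ (distance x x)) [])

    d≡0⇒≡ : ∀ {x y} → d x y ≡ 0 → x ≡ y
    d≡0⇒≡ {x} {y} eq with subst (Walk x y) eq (proj₁ (proj₂ (distance x y)))
    ... | [] = refl

    ⊤-weakTotalResolving : WeakTotalResolving ⊤
    ⊤-weakTotalResolving =
      (λ y z y≢z → y , ∈⊤ , λ eq → y≢z (sym (d≡0⇒≡ (trans (sym eq) (d-refl y))))) ,
      (λ _ _ _ x∉⊤ → contradiction ∈⊤ x∉⊤)

    WTRCardinality : Pred ℕ 0ℓ
    WTRCardinality k = ∃ λ W → WeakTotalResolving W × ∣ W ∣ ≡ k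

    weakTotalDimension : ∃ (IsMinimum WTRCardinality)
    weakTotalDimension =
      minimum (λ k → anySubset? λ W → weakTotalResolving? W ×-dec (∣ W ∣ ℕ.≟ k))
              ∣ ⊤ {n} ∣ (⊤ , ⊤-weakTotalResolving , refl)

    dim-wt : ℕ
    dim-wt = proj₁ weakTotalDimension

    WeakTotalMetricBasis : Subset n → Set
    WeakTotalMetricBasis W = WeakTotalResolving W × ∣ W ∣ ≡ dim-wt

{-# OPTIONS --safe #-}

-- A neighbour y of u satisfies |d(y,v) - d(u,v)| ≤ 1, and weak total resolution
-- rules out d(y,v) = d(u,v), so d(y,v) takes at most two values.  All neighbours
-- of u are at distance 1 from u, hence only v can resolve two of them, and
-- distinct neighbours have distinct distances to v.

module Submission where

open import Defs
open import Data.Fin.Base using (Fin; punchOut)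
open import Data.Fin.Patterns using (0F; 1F)
open import Data.Fin.Properties using (_≟_; suc-injective; punchOut-injective)
open import Data.Fin.Subset using (Subset; inside; outside; ⁅_⁆; _∪_; _-_; _∈_; _∉_; ∣_∣)
open import Data.Fin.Subset.Properties
  using (x∈⁅x⁆; x∈⁅y⁆⇒x≡y; x∈p∪q⁺; x∈p∪q⁻; p─q⊆p; p─q─q≡p─q; x∈p⇒∣p-x∣<∣p∣)
open import Data.Nat.Base using (ℕ; zero; suc; _≤_; z≤n; s≤s)
import Data.Nat.Properties as ℕ
open import Data.Product.Base using (_×_; _,_; proj₁; proj₂)
open import Data.Sum.Base as Sum using (_⊎_; inj₁; inj₂; swap)
open import Data.Vec.Base using ([]; _∷_; here; there)
open import Data.Vec.Properties using (lookup∘tabulate; []=⇒lookup)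
open import Function.Base using (_∘_)
open import Relation.Binary.Definitions using (tri<; tri≈; tri>)
open import Relation.Binary.PropositionalEquality
  using (_≡_; _≢_; refl; sym; trans; cong; subst)
open import Relation.Nullary.Decidable using (yes; no)
open import Relation.Nullary.Negation using (contradiction)

-- Pigeonhole by induction on `p`. The map takes the membership proof as an argument, so it may be
-- defined on `p` only and be computed from that proof.
injectiveOn⇒∣p∣≤ : ∀ {n m} (p : Subset n) (f : ∀ {x} → x ∈ p → Fin m) →
                   (∀ {x y} (x∈p : x ∈ p) (y∈p : y ∈ p) → f x∈p ≡ f y∈p → x ≡ y) →
                   ∣ p ∣ ≤ m
injectiveOn⇒∣p∣≤ [] f inj = z≤n
injectiveOn⇒∣p∣≤ (outside ∷ p) f inj =
  injectiveOn⇒∣p∣≤ p (f ∘ there)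
    λ x∈p y∈p eq → suc-injective (inj (there x∈p) (there y∈p) eq)
injectiveOn⇒∣p∣≤ {m = zero} (inside ∷ p) f inj with () ← f here
injectiveOn⇒∣p∣≤ {m = suc m} (inside ∷ p) f inj =
  -- The value `f here` is deleted from the codomain; by injectivity no later member attains it.
  s≤s (injectiveOn⇒∣p∣≤ p (λ x∈p → punchOut (f₀≢ x∈p))
    λ x∈p y∈p eq → suc-injective
      (inj (there x∈p) (there y∈p) (punchOut-injective (f₀≢ x∈p) (f₀≢ y∈p) eq)))
  where
  f₀≢ : ∀ {x} (x∈p : x ∈ p) → f here ≢ f (there x∈p)
  f₀≢ x∈p eq with () ← inj here (there x∈p) eq

-- A second removal of `x` changes nothing, whereas removing a member strictly lowers the
-- cardinality.
x∉p-x : ∀ {n} (p : Subset n) (x : Fin n) → x ∉ p - x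
x∉p-x p x x∈p-x =
  ℕ.<-irrefl (cong ∣_∣ (p─q─q≡p─q p ⁅ x ⁆)) (x∈p⇒∣p-x∣<∣p∣ x∈p-x)

module _ {n : ℕ} (G : Graph n) where
  open Graph G

  ∈-neighbours⇒~ : ∀ {x y} → y ∈ neighbours G x → x ~ y
  ∈-neighbours⇒~ {x} {y} y∈N
    with x ~? y | trans (sym (lookup∘tabulate _ y)) ([]=⇒lookup y∈N)
  ... | yes x~y | _ = x~y

  module _ (conn : Connected G) where

    private
      dist : Fin n → Fin n → ℕ
      dist = d G conn

    -- The edge followed by a shortest walk from `y` to `z` is a walk from `x` to `z`.
    d-step : ∀ {x y} → x ~ y → ∀ z → dist x z ≤ suc (dist y z)
    d-step {x} {y} x~y z =
      proj₂ (proj₂ (distance G conn x z)) (x~y ∷ proj₁ (proj₂ (distance G conn y z)))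

    ~⇒≢ : ∀ {x y} → x ~ y → x ≢ y
    ~⇒≢ x~y x≡y = ~-irrefl x≡y x~y

    ~⇒d≡1 : ∀ {x y} → x ~ y → dist x y ≡ 1
    ~⇒d≡1 {x} {y} x~y = ℕ.≤-antisym
      (subst (λ k → dist x y ≤ suc k) (d-refl G conn y) (d-step x~y y))
      (ℕ.n≢0⇒n>0 (~⇒≢ x~y ∘ d≡0⇒≡ G conn))

    -- Membership in `W` is given as a disjunction, so that `swap` yields the same bound for the
    -- other vertex.
    degree≤2 : ∀ {W u v} → WeakTotalResolving G conn W →
               u ∈ W → (∀ {w} → w ∈ W → w ≡ u ⊎ w ≡ v) → degree G u ≤ 2
    degree≤2 {W} {u} {v} (resolving , total) u∈W W⊆uv =
      injectiveOn⇒∣p∣≤ (neighbours G u) (λ y∈N → side (offset (∈-neighbours⇒~ y∈N)))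
        λ x∈N y∈N eq → dv-injective (∈-neighbours⇒~ x∈N) (∈-neighbours⇒~ y∈N)
          (side-injective (offset (∈-neighbours⇒~ x∈N)) (offset (∈-neighbours⇒~ y∈N)) eq)
      where
      -- The lower value is expressed by `suc a`, avoiding truncated subtraction when `dist u v` is
      -- zero.
      Offset : ℕ → Set
      Offset a = suc a ≡ dist u v ⊎ a ≡ suc (dist u v)

      side : ∀ {a} → Offset a → Fin 2
      side (inj₁ _) = 0F
      side (inj₂ _) = 1F

      side-injective : ∀ {a b} (s : Offset a) (t : Offset b) → side s ≡ side t → a ≡ b
      side-injective (inj₁ p) (inj₁ q) _ = ℕ.suc-injective (trans p (sym q))
      side-injective (inj₂ p) (inj₂ q) _ = trans p (sym q)

      dv≢ : ∀ {y} → u ~ y → dist y v ≢ dist u v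
      dv≢ {y} u~y eq with y ≟ v
      -- Weak total resolution concerns only vertices outside `W`, so `y = v` is treated apart: `eq`
      -- would equate `dist v v`, which is 0, with `dist u v`, which is 1.
      ... | yes refl with () ← trans (sym (~⇒d≡1 u~y)) (trans (sym eq) (d-refl G conn v))
      ... | no y≢v with total u u∈W y y∉W
        where
        y∉W : y ∉ W
        y∉W = Sum.[ ~⇒≢ u~y ∘ sym , y≢v ] ∘ W⊆uv
      ...   | w , w∈W-u , dw≢ with W⊆uv (p─q⊆p W ⁅ u ⁆ w∈W-u)
      ...     | inj₁ refl = x∉p-x W u w∈W-u
      ...     | inj₂ refl = dw≢ eq

      offset : ∀ {y} → u ~ y → Offset (dist y v)
      offset {y} u~y with ℕ.<-cmp (dist y v) (dist u v)
      -- A strict inequality on naturals is already `suc` of one side `≤` the other; `d-step` along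
      -- the edge, in the suitable direction, gives the converse bound.
      ... | tri< dy<du _ _ = inj₁ (ℕ.≤-antisym dy<du (d-step u~y v))
      ... | tri≈ _ dy≡du _ = contradiction dy≡du (dv≢ u~y)
      ... | tri> _ _ du<dy = inj₂ (ℕ.≤-antisym (d-step (~-sym u~y) v) du<dy)

      dv-injective : ∀ {x y} → u ~ x → u ~ y → dist x v ≡ dist y v → x ≡ y
      dv-injective {x} {y} u~x u~y eq with x ≟ y
      ... | yes x≡y = x≡y
      ... | no x≢y with resolving x y x≢y
      ...   | w , w∈W , dw≢ with W⊆uv w∈W
      ...     | inj₁ refl = contradiction (trans (~⇒d≡1 (~-sym u~x)) (sym (~⇒d≡1 (~-sym u~y)))) dw≢
      ...     | inj₂ refl = contradiction eq dw≢

theorem1 : ∀ (n : ℕ) (G : Graph n) (conn : Connected G) →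
    dim-wt G conn ≡ 2 →
    ∀ (u v : Fin n) → WeakTotalMetricBasis G conn (⁅ u ⁆ ∪ ⁅ v ⁆) →
    degree G u ≤ 2 × degree G v ≤ 2
theorem1 n G conn _ u v (wtr , _) =
  degree≤2 G conn wtr (x∈p∪q⁺ (inj₁ (x∈⁅x⁆ u))) W⊆uv ,
  degree≤2 G conn wtr (x∈p∪q⁺ (inj₂ (x∈⁅x⁆ v))) (swap ∘ W⊆uv)
  where
  W⊆uv : ∀ {w} → w ∈ ⁅ u ⁆ ∪ ⁅ v ⁆ → w ≡ u ⊎ w ≡ v
  W⊆uv = Sum.map (x∈⁅y⁆⇒x≡y u) (x∈⁅y⁆⇒x≡y v) ∘ x∈p∪q⁻ ⁅ u ⁆ ⁅ v ⁆
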